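{- Let $\sigma$ be a finite nonempty signature of atoms. The class $\mathcal Q_p^\sigma[\mathsf U]$ is exponentially characterisable within $\mathcal Q_p^\sigma[\mathsf U]$; that is, there is a polynomial $p$ such that every $q\in\mathcal Q_p^\sigma[\mathsf U]$ is uniquely characterised within $\mathcal Q_p^\sigma[\mathsf U]$ by some example set $E$ with $|E|\le 2^{p(|q|)}$.
   Context: A $\sigma$-data instance is a finite sequence $\mathcal D=(\delta_0,\dots,\delta_n)$ with $\delta_i\subseteq\sigma$, identified with its extensions by trailing $\emptyset$'s (so $\delta_\ell=\emptyset$ for $\ell>n$); $|\mathcal D|=\sum_i|\delta_i|$. Semantics at $\ell\in\mathbb N$: $\mathcal D,\ell\models A$ iff $A\in\delta_\ell$; $\mathcal D,\ell\models\top$; $\mathcal D,\ell\not\models\bot$; conjunction as usual; $\mathcal D,\ell\models q_1\mathbin{\mathsf U}q_2$ iff there is $m>\ell$ with $\mathcal D,m\models q_2$ and $\mathcal D,k\models q_1$ for all $k$ with $\ell<k<m$. Queries are equivalent ($q\equiv q'$) if they are true at the same $(\mathcal D,\ell)$. $|q|$ is the number of symbols in $q$. $\mathcal Q_p^\sigma[\mathsf U]$ is the class of queries $q=\rho_0\wedge(\lambda_1\mathbin{\mathsf U}(\rho_1\wedge(\lambda_2\mathbin{\mathsf U}(\dots(\lambda_n\mathbin{\mathsf U}\rho_n)\dots))))$, $n\ge0$, where each $\rho_i$ is a (possibly empty) conjunction of atoms from $\sigma$ and each $\lambda_i$ is either $\bot$ or a (possibly empty) conjunction of atoms from $\sigma$;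 the empty conjunction is $\top$. An example set is a pair $E=(E^+,E^-)$ of finite sets of $\sigma$-data instances, $|E|=\sum_{\mathcal D\in E^+\cup E^- }|\mathcal D|$. A query $q$ fits $E$ if $\mathcal D,0\models q$ for all $\mathcal D\in E^+$ and $\mathcal D,0\not\models q$ for all $\mathcal D\in E^-$. $E$ uniquely characterises $q$ within a class $\mathcal Q$ if $q$ fits $E$ and $q\equiv q'$ for all $q'\in\mathcal Q$ that fit $E$. -}

module Defs where

open import Data.Empty using (⊥)
open import Data.Fin using (Fin)
open import Data.Fin.Subset as Subset using (Subset; ∣_∣)
open import Data.List using (List; []; _∷_; _++_; map; foldr; sum)
open import Data.List.Relation.Unary.All using (All)
open import Data.Nat using (ℕ; zero; suc; _+_; _*_; _^_; _≤_; _<_)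
open import Data.Product using (∃-syntax; _×_)
open import Data.Unit using (⊤)
open import Function.Bundles using (_⇔_)
open import Level using (0ℓ)
open import Relation.Nullary using (¬_)
open import Relation.Unary using (Pred)

-- Throughout, the signature σ with s atoms is Fin s.

-- A list stands for all its extensions by trailing ∅'s: the size and the
-- semantics below depend only on the infinite sequence given by _at_.

DataInstance : ℕ → Set
DataInstance s = List (Subset s)

_at_ : ∀ {s} → DataInstance s → ℕ → Subset s
[]      at ℓ     = Subset.⊥
(δ ∷ D) at zero  = δ
(δ ∷ D) at suc ℓ = D at ℓ

sizeᴰ : ∀ {s} → DataInstance s → ℕ
sizeᴰ D = sum (map ∣_∣ D)

infixr 7 _∧̇_
infixr 8 _U̇_

data Query (s : ℕ) : Set where
  atom      : Fin s → Query s
  ⊤̇ ⊥̇       : Query s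
  _∧̇_ _U̇_   : Query s → Query s → Query s

-- Parentheses are not counted as symbols.

sizeQ : ∀ {s} → Query s → ℕ
sizeQ (atom A)  = 1
sizeQ ⊤̇         = 1
sizeQ ⊥̇         = 1
sizeQ (q₁ ∧̇ q₂) = sizeQ q₁ + 1 + sizeQ q₂
sizeQ (q₁ U̇ q₂) = sizeQ q₁ + 1 + sizeQ q₂

infix 4 _,_⊨_ _≡Q_

_,_⊨_ : ∀ {s} → DataInstance s → ℕ → Query s → Set
D , ℓ ⊨ atom A    = A Subset.∈ (D at ℓ)
D , ℓ ⊨ ⊤̇         = ⊤
D , ℓ ⊨ ⊥̇         = ⊥
D , ℓ ⊨ (q₁ ∧̇ q₂) = (D , ℓ ⊨ q₁) × (D , ℓ ⊨ q₂)
D , ℓ ⊨ (q₁ U̇ q₂) =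
  ∃[ m ] ℓ < m × (D , m ⊨ q₂) × (∀ k → ℓ < k → k < m → D , k ⊨ q₁)

_≡Q_ : ∀ {s} → Query s → Query s → Set
q ≡Q q′ = ∀ D ℓ → (D , ℓ ⊨ q) ⇔ (D , ℓ ⊨ q′)

QueryClass : ℕ → Set₁
QueryClass s = Pred (Query s) 0ℓ

⋀ : ∀ {s} → List (Fin s) → Query s
⋀ []           = ⊤̇
⋀ (A ∷ [])     = atom A
⋀ (A ∷ B ∷ As) = atom A ∧̇ ⋀ (B ∷ As)

data IsConj {s : ℕ} : QueryClass s where
  conj : (As : List (Fin s)) → IsConj (⋀ As)

data IsGuard {s : ℕ} : QueryClass s where
  bot  : IsGuard ⊥̇
  conj : ∀ {λ₁} → IsConj λ₁ → IsGuard λ₁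

data 𝒬p[U] {s : ℕ} : QueryClass s where
  last : ∀ {ρ} → IsConj ρ → 𝒬p[U] ρ
  step : ∀ {ρ λ₁ q} → IsConj ρ → IsGuard λ₁ → 𝒬p[U] q → 𝒬p[U] (ρ ∧̇ (λ₁ U̇ q))

-- Finite sets of data instances are given by lists.  A repeated entry is
-- counted again in sizeᴱ, so sizeᴱ is never below the size of the underlying
-- sets and equals it when they are listed without repetition.

record ExampleSet (s : ℕ) : Set where
  constructor examples
  field
    E⁺ E⁻ : List (DataInstance s)

open ExampleSet public

sizeᴱ : ∀ {s} → ExampleSet s → ℕ
sizeᴱ E = sum (map sizeᴰ (E⁺ E ++ E⁻ E))

Fits : ∀ {s} → Query s → ExampleSet s → Set
Fits q E = All (λ D → D , 0 ⊨ q) (E⁺ E) × All (λ D → ¬ (D , 0 ⊨ q)) (E⁻ E)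

UniquelyCharacterises : ∀ {s} → ExampleSet s → Query s → QueryClass s → Set
UniquelyCharacterises E q 𝒬 =
  Fits q E × (∀ q′ → 𝒬 q′ → Fits q′ E → q ≡Q q′)

-- Coefficients, constant term first.  Natural coefficients suffice for upper
-- bounds, since every integer polynomial is bounded on ℕ by one of these.

Polynomial : Set
Polynomial = List ℕ

eval : Polynomial → ℕ → ℕ
eval p x = foldr (λ c r → c + x * r) 0 p

ExponentiallyCharacterisable : ∀ {s} → QueryClass s → QueryClass s → Set
ExponentiallyCharacterisable {s} 𝒬 𝒬′ =
  ∃[ p ] ∀ (q : Query s) → 𝒬 q →
    ∃[ E ] UniquelyCharacterises E q 𝒬′ × sizeᴱ E ≤ 2 ^ eval p (sizeQ q)

{-# OPTIONS --safe #-}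

-- The positive example ρ₀ρ₁…ρₙ forces every fitting query to be equivalent to
-- one of depth at most n + 1: whatever it matches beyond the end is true on the
-- trailing ∅'s and can be cut off.  There are only exponentially many such
-- queries up to equivalence.  Each inequivalent one is separated from q by an
-- instance of at most exponential length: read backwards, an instance updates
-- the truth values of all subqueries of both queries deterministically, so the
-- part between two positions with equal truth values can be removed.

module Submission where

open import Defs
open import Data.Bool using (Bool; true; false; T; _∧_; _∨_)
open import Data.Bool.Properties using (T-∧; T-∨; T-≡) renaming (_≟_ to _≟ᵇ_)
open import Data.Empty using (⊥-elim)
open import Data.Fin using (Fin; zero; suc; combine; toℕ)
open import Data.Fin.Properties using (pigeonhole; combine-injective; toℕ≤pred[n])
open import Data.Fin.Subset as Subset using (Subset; _⊆_; _∪_; ⁅_⁆)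
open import Data.Fin.Subset.Properties
  using (_⊆?_; ⊥⊆; x∈p∪q⁻; x∈p∪q⁺; x∈⁅x⁆; x∈⁅y⁆⇒x≡y; ∣p∣≤n)
open import Data.List
  using (List; []; _∷_; _++_; map; length; drop; take; filter; cartesianProduct; cartesianProductWith)
open import Data.List.Membership.Propositional using (_∈_; find; lose)
open import Data.List.Membership.Propositional.Properties
  using (∈-map⁺; ∈-filter⁺; ∈-cartesianProduct⁺; ∈-cartesianProductWith⁺; ∈-cartesianProductWith⁻)
open import Data.List.Properties
  using (length-map; length-++; length-filter; length-drop; length-take; take++drop≡id)
open import Data.List.Relation.Unary.All as All using (All; []; _∷_)
open import Data.List.Relation.Unary.All.Properties as Allₚ using (all-filter)
open import Data.List.Relation.Unary.Any using (here; there; any?)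
open import Data.Maybe using (Maybe; just; nothing)
open import Data.Nat
  using (ℕ; zero; suc; _+_; _*_; _^_; _∸_; _⊓_; _≤_; _<_; NonZero; z≤n; s≤s; _≤?_)
open import Data.Nat.Induction using (<-wellFounded)
open import Data.Nat.ListAction using (sum)
open import Data.Nat.Properties
open import Data.Nat.Solver using (module +-*-Solver)
open import Data.Product using (_×_; _,_; proj₁; proj₂; ∃-syntax)
open import Data.Product.Function.NonDependent.Propositional using (_×-⇔_)
open import Data.Sum using (_⊎_; inj₁; inj₂; [_,_]′)
open import Data.Sum.Function.Propositional using (_⊎-⇔_)
open import Data.Unit using (tt)
open import Data.Vec as Vec using (Vec; []; _∷_)
open import Data.Vec.Properties using (∷-injective; ++-injective)
open import Function using (_∘_)
open import Function.Bundles using (_⇔_; mk⇔; Equivalence)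
open import Function.Properties.Equivalence using () renaming (trans to infixr 9 _⇔⨾_)
open import Function.Construct.Identity using (⇔-id)
open import Function.Construct.Symmetry using (⇔-sym)
open import Induction.WellFounded using (Acc; acc)
open import Relation.Binary.PropositionalEquality
  using (_≡_; _≢_; refl; sym; trans; cong; cong₂; subst; _≗_)
open import Relation.Nullary using (¬_; Dec; yes; no; ⌊_⌋; contradiction)
open import Relation.Nullary.Decidable using (toWitness; fromWitness; decidable-stable; T?; ¬?)

open Equivalence using (to; from)

private variable
  s : ℕ
  A B C : Set

-- Semantics of until

-- No connective looks at positions before the current one, so the first position can be removed.
-- Relating the instances through `_at_` treats `[]` and `δ ∷ D` alike.
⊨-shift : (D D′ : DataInstance s) → (∀ ℓ → D at suc ℓ ≡ D′ at ℓ) →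
          ∀ q ℓ → (D , suc ℓ ⊨ q) ⇔ (D′ , ℓ ⊨ q)
⊨-shift D D′ eq (atom A) ℓ rewrite eq ℓ = ⇔-id _
⊨-shift D D′ eq ⊤̇ ℓ = ⇔-id _
⊨-shift D D′ eq ⊥̇ ℓ = ⇔-id _
⊨-shift D D′ eq (q₁ ∧̇ q₂) ℓ = ⊨-shift D D′ eq q₁ ℓ ×-⇔ ⊨-shift D D′ eq q₂ ℓ
⊨-shift D D′ eq (q₁ U̇ q₂) ℓ = mk⇔
  (λ { (suc m , s≤s ℓ<m , h₂ , h₁) →
       m , ℓ<m , to (⊨-shift D D′ eq q₂ m) h₂ ,
       λ k ℓ<k k<m → to (⊨-shift D D′ eq q₁ k) (h₁ (suc k) (s≤s ℓ<k) (s≤s k<m)) })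
  (λ { (m , ℓ<m , h₂ , h₁) →
       suc m , s≤s ℓ<m , from (⊨-shift D D′ eq q₂ m) h₂ ,
       λ { (suc k) (s≤s ℓ<k) (s≤s k<m) → from (⊨-shift D D′ eq q₁ k) (h₁ k ℓ<k k<m) } })

⊨-drop : ∀ (D : DataInstance s) q ℓ → (D , suc ℓ ⊨ q) ⇔ (drop 1 D , ℓ ⊨ q)
⊨-drop D = ⊨-shift D (drop 1 D) (at-suc D)
  where
  at-suc : ∀ D ℓ → D at suc ℓ ≡ drop 1 D at ℓ
  at-suc []      ℓ = refl
  at-suc (δ ∷ D) ℓ = refl

-- Examples test position 0 only, whereas `_≡Q_` asks for all positions; a later position is
-- position 0 of a suffix, which is itself an instance.
≡Q-from-0 : {q q′ : Query s} → (∀ D → (D , 0 ⊨ q) ⇔ (D , 0 ⊨ q′)) → q ≡Q q′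
≡Q-from-0 h D zero = h D
≡Q-from-0 {q = q} {q′} h D (suc ℓ) =
  ⊨-drop D q ℓ ⇔⨾ (≡Q-from-0 h (drop 1 D) ℓ ⇔⨾ ⇔-sym (⊨-drop D q′ ℓ))

-- The fixpoint expansion of strict until: its witness is either the next position or a later one.
-- It justifies the last clause of `until`.
U-unfold : ∀ (D : DataInstance s) q₁ q₂ →
           (D , 0 ⊨ q₁ U̇ q₂) ⇔
           ((drop 1 D , 0 ⊨ q₂) ⊎ (drop 1 D , 0 ⊨ q₁) × (drop 1 D , 0 ⊨ q₁ U̇ q₂))
U-unfold D q₁ q₂ = mk⇔ fwd bwd
  where
  fwd : (D , 0 ⊨ q₁ U̇ q₂) →
        ((drop 1 D , 0 ⊨ q₂) ⊎ (drop 1 D , 0 ⊨ q₁) × (drop 1 D , 0 ⊨ q₁ U̇ q₂))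
  fwd (suc zero , _ , h₂ , _) = inj₁ (to (⊨-drop D q₂ 0) h₂)
  fwd (suc (suc m) , _ , h₂ , h₁) = inj₂
    ( to (⊨-drop D q₁ 0) (h₁ 1 (s≤s z≤n) (s≤s (s≤s z≤n)))
    , suc m , s≤s z≤n , to (⊨-drop D q₂ (suc m)) h₂
    , λ k _ k<m → to (⊨-drop D q₁ k) (h₁ (suc k) (s≤s z≤n) (s≤s k<m)) )

  bwd : ((drop 1 D , 0 ⊨ q₂) ⊎ (drop 1 D , 0 ⊨ q₁) × (drop 1 D , 0 ⊨ q₁ U̇ q₂)) →
        (D , 0 ⊨ q₁ U̇ q₂)
  bwd (inj₁ h₂) = 1 , s≤s z≤n , from (⊨-drop D q₂ 0) h₂ ,
                  λ { (suc k) _ (s≤s ()) }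
  bwd (inj₂ (h , m , _ , h₂ , h₁)) =
    suc m , s≤s z≤n , from (⊨-drop D q₂ m) h₂ ,
    λ { (suc zero) _ _ → from (⊨-drop D q₁ 0) h
      ; (suc (suc k)) _ (s≤s k<m) → from (⊨-drop D q₁ (suc k)) (h₁ (suc k) (s≤s z≤n) k<m) }

-- All positions of `[]` look alike, so the witness can be taken to be the next position, with
-- nothing in between for the guard to hold at.
⊨-[]-U : ∀ {q₁ q₂ : Query s} ℓ → ([] , ℓ ⊨ q₁ U̇ q₂) ⇔ ([] , 0 ⊨ q₂)
⊨-[]-U {q₁ = q₁} {q₂} ℓ = mk⇔
  (λ { (m , _ , h₂ , _) → to (constant m) h₂ })
  (λ h → suc ℓ , ≤-refl , from (constant (suc ℓ)) h ,
         λ { k ℓ<k (s≤s k≤ℓ) → contradiction ℓ<k (≤⇒≯ k≤ℓ) })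
  where
  constant : ∀ m → ([] , m ⊨ q₂) ⇔ ([] , 0 ⊨ q₂)
  constant zero    = ⇔-id _
  constant (suc m) = ⊨-drop [] q₂ m ⇔⨾ constant m

-- Normal forms and their evaluation

-- The path query (ρ₀ , (λ₁ , ρ₁) ∷ … ∷ (λₙ , ρₙ) ∷ []), with conjunctions
-- represented by sets of atoms and the guard ⊥ by nothing.

Guard : ℕ → Set
Guard s = Maybe (Subset s)

Path : ℕ → Set
Path s = List (Guard s × Subset s)

PathQuery : ℕ → Set
PathQuery s = Subset s × Path s

_⊆ᵇ_ : Subset s → Subset s → Bool
r ⊆ᵇ δ = ⌊ r ⊆? δ ⌋

⊆⇔⊆ᵇ : (r δ : Subset s) → (r ⊆ δ) ⇔ T (r ⊆ᵇ δ)
⊆⇔⊆ᵇ r δ = mk⇔ (fromWitness {A = r ⊆ δ}) (toWitness {A = r ⊆ δ})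

permits : Guard s → Subset s → Bool
permits nothing  δ = false
permits (just l) δ = l ⊆ᵇ δ

-- until ps D is the truth value of λ₁ U (ρ₁ ∧ …) at position 0 of D.

until : Path s → DataInstance s → Bool
until []             D       = true
until ((l , r) ∷ ps) []      = (r ⊆ᵇ Subset.⊥) ∧ until ps []
until ((l , r) ∷ ps) (δ ∷ D) =
  ((r ⊆ᵇ (D at 0)) ∧ until ps D) ∨ (permits l (D at 0) ∧ until ((l , r) ∷ ps) D)

holds : PathQuery s → DataInstance s → Bool
holds (r , ps) D = (r ⊆ᵇ (D at 0)) ∧ until ps D

atoms : List (Fin s) → Subset s
atoms []       = Subset.⊥
atoms (A ∷ As) = ⁅ A ⁆ ∪ atoms As

⁅⁆⊆ : ∀ {A : Fin s} {δ} → A Subset.∈ δ → ⁅ A ⁆ ⊆ δ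
⁅⁆⊆ {A = A} A∈δ x∈ with refl ← x∈⁅y⁆⇒x≡y A x∈ = A∈δ

⊨-⋀ : ∀ (As : List (Fin s)) D → (D , 0 ⊨ ⋀ As) ⇔ (atoms As ⊆ D at 0)
⊨-⋀ [] D = mk⇔ {B = atoms [] ⊆ D at 0} (λ _ → ⊥⊆) (λ _ → tt)
⊨-⋀ (A ∷ []) D = mk⇔ {B = atoms (A ∷ []) ⊆ D at 0}
  (λ A∈δ x∈ → [ ⁅⁆⊆ A∈δ , ⊥⊆ ]′ (x∈p∪q⁻ ⁅ A ⁆ Subset.⊥ x∈))
  (λ sub → sub (x∈p∪q⁺ (inj₁ (x∈⁅x⁆ A))))
⊨-⋀ (A ∷ As@(_ ∷ _)) D = mk⇔ {B = atoms (A ∷ As) ⊆ D at 0}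
  (λ h x∈ → [ ⁅⁆⊆ (proj₁ h) , to (⊨-⋀ As D) (proj₂ h) ]′ (x∈p∪q⁻ ⁅ A ⁆ (atoms As) x∈))
  (λ sub → sub (x∈p∪q⁺ (inj₁ (x∈⁅x⁆ A))) ,
           from (⊨-⋀ As D) (λ x∈ → sub (x∈p∪q⁺ {p = ⁅ A ⁆} (inj₂ x∈))))

conj-normal : ∀ {ρ : Query s} → IsConj ρ →
              ∃[ r ] ∀ D → (D , 0 ⊨ ρ) ⇔ T (r ⊆ᵇ (D at 0))
conj-normal (conj As) = atoms As , λ D → ⊨-⋀ As D ⇔⨾ ⊆⇔⊆ᵇ (atoms As) (D at 0)

guard-normal : ∀ {λ₁ : Query s} → IsGuard λ₁ →
               ∃[ l ] ∀ D → (D , 0 ⊨ λ₁) ⇔ T (permits l (D at 0))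
guard-normal bot = nothing , λ D → ⇔-id _
guard-normal (conj c) = let l , h = conj-normal c in just l , h

until-correct : ∀ {λ₁ q : Query s} {l r ps} →
                (∀ D → (D , 0 ⊨ λ₁) ⇔ T (permits l (D at 0))) →
                (∀ D → (D , 0 ⊨ q) ⇔ T (holds (r , ps) D)) →
                ∀ D → (D , 0 ⊨ λ₁ U̇ q) ⇔ T (until ((l , r) ∷ ps) D)
until-correct hλ hq [] = ⊨-[]-U 0 ⇔⨾ hq []
until-correct {λ₁ = λ₁} {q} hλ hq (δ ∷ D) =
  U-unfold (δ ∷ D) λ₁ q ⇔⨾
  ((hq D ⊎-⇔ ((hλ D ×-⇔ until-correct hλ hq D) ⇔⨾ ⇔-sym T-∧)) ⇔⨾ ⇔-sym T-∨)

sizeQ-positive : (q : Query s) → 1 ≤ sizeQ q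
sizeQ-positive (atom A)  = ≤-refl
sizeQ-positive ⊤̇         = ≤-refl
sizeQ-positive ⊥̇         = ≤-refl
sizeQ-positive (q₁ ∧̇ q₂) = m≤n⇒m≤n+o (sizeQ q₂) (m≤n+m 1 (sizeQ q₁))
sizeQ-positive (q₁ U̇ q₂) = m≤n⇒m≤n+o (sizeQ q₂) (m≤n+m 1 (sizeQ q₁))

normalise : ∀ {q : Query s} → 𝒬p[U] q →
            ∃[ p ] (∀ D → (D , 0 ⊨ q) ⇔ T (holds p D)) × suc (length (proj₂ p)) ≤ sizeQ q
normalise {q = q} (last c) with r , h ← conj-normal c =
  (r , []) , (λ D → h D ⇔⨾ (mk⇔ (_, tt) proj₁ ⇔⨾ ⇔-sym T-∧)) , sizeQ-positive q
normalise (step {ρ} {λ₁} {q} c g 𝒬q)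
  with r , hρ ← conj-normal c | l , hλ ← guard-normal g | (r′ , ps) , hq , n≤ ← normalise 𝒬q =
  (r , (l , r′) ∷ ps) ,
  (λ D → (hρ D ×-⇔ until-correct hλ hq D) ⇔⨾ ⇔-sym T-∧) ,
  -- The symbol `∧̇` pays for the additional label of the path.
  +-mono-≤ (m≤n+m 1 (sizeQ ρ)) (≤-trans n≤ (m≤n+m (sizeQ q) (sizeQ λ₁ + 1)))

-- Bounding the depth

-- Truth on `[]` forces every conjunction on the path to be empty; such a path is matched step by
-- step in any instance.
until-[]⇒true : ∀ (ps : Path s) → T (until ps []) → ∀ D → until ps D ≡ true
until-[]⇒true [] h D = refl
until-[]⇒true ((l , r) ∷ ps) h [] = to T-≡ h
until-[]⇒true ((l , r) ∷ ps) h (δ ∷ D) with r⊆⊥ , t ← to T-∧ h =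
  to T-≡ (from T-∨ (inj₁ (from T-∧
    ( to (⊆⇔⊆ᵇ r (D at 0)) (λ x∈ → ⊥⊆ (from (⊆⇔⊆ᵇ r Subset.⊥) r⊆⊥ x∈))
    , from T-≡ (until-[]⇒true ps t D)))))

until-∷-cong : ∀ {l} {r : Subset s} {ps ps′} → until ps ≗ until ps′ →
               until ((l , r) ∷ ps) ≗ until ((l , r) ∷ ps′)
until-∷-cong {r = r} eq [] = cong ((r ⊆ᵇ Subset.⊥) ∧_) (eq [])
until-∷-cong {l = l} {r} eq (δ ∷ D) =
  cong₂ (λ b c → ((r ⊆ᵇ (D at 0)) ∧ b) ∨ (permits l (D at 0) ∧ c)) (eq D) (until-∷-cong eq D)

-- The part of a path that is matched in the trailing ∅'s is always true.

trim : ∀ (ps : Path s) D → T (until ps D) →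
       ∃[ ps′ ] length ps′ ≤ length D × until ps ≗ until ps′
trim [] D h = [] , z≤n , λ _ → refl
trim ps@(_ ∷ _) [] h = [] , z≤n , until-[]⇒true ps h
trim ((l , r) ∷ ps) (δ ∷ D) h with to T-∨ h
... | inj₁ now = let ps′ , ≤D , eq = trim ps D (proj₂ (to (T-∧ {r ⊆ᵇ (D at 0)}) now))
                 in (l , r) ∷ ps′ , s≤s ≤D , until-∷-cong eq
-- No label is consumed by this position, so the whole path is trimmed against the rest and its
-- equivalence is passed on unchanged.
... | inj₂ later = let ps′ , ≤D , eq = trim ((l , r) ∷ ps) D (proj₂ (to (T-∧ {permits l (D at 0)}) later))
                   in ps′ , m≤n⇒m≤1+n ≤D , eq

canonical : PathQuery s → DataInstance s
canonical (r , ps) = r ∷ map proj₂ ps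

⊆ᵇ-refl : (r : Subset s) → T (r ⊆ᵇ r)
⊆ᵇ-refl r = to (⊆⇔⊆ᵇ r r) (λ x∈ → x∈)

-- Each until is fulfilled at the very next position, which leaves no position where a guard would
-- have to hold.
until-canonical : ∀ (ps : Path s) δ → T (until ps (δ ∷ map proj₂ ps))
until-canonical [] δ = tt
until-canonical ((l , r) ∷ ps) δ =
  from T-∨ (inj₁ (from T-∧ (⊆ᵇ-refl r , until-canonical ps r)))

holds-canonical : ∀ (p : PathQuery s) → T (holds p (canonical p))
holds-canonical (r , ps) = from T-∧ (⊆ᵇ-refl r , until-canonical ps r)

-- Short distinguishing instances

-- Numbers the states, since `pigeonhole` speaks of `Fin`.
encode : ∀ {k} → Vec Bool k → Fin (2 ^ k)
encode []          = zero
encode (false ∷ v) = combine {2} zero (encode v)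
encode (true  ∷ v) = combine {2} (suc zero) (encode v)

encode-injective : ∀ {k} {v w : Vec Bool k} → encode v ≡ encode w → v ≡ w
encode-injective {v = []} {[]} _ = refl
encode-injective {v = false ∷ v} {false ∷ w} eq =
  cong (false ∷_) (encode-injective (proj₂ (combine-injective {2} zero (encode v) zero (encode w) eq)))
encode-injective {v = true ∷ v} {true ∷ w} eq =
  cong (true ∷_) (encode-injective (proj₂ (combine-injective {2} (suc zero) (encode v) (suc zero) (encode w) eq)))
encode-injective {v = false ∷ v} {true ∷ w} eq
  with () ← proj₁ (combine-injective {2} zero (encode v) (suc zero) (encode w) eq)
encode-injective {v = true ∷ v} {false ∷ w} eq
  with () ← proj₁ (combine-injective {2} (suc zero) (encode v) zero (encode w) eq)

-- A word longer than the number of states has two suffixes with the same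
-- state; cutting out the part between them does not change the state.

shorten : ∀ {k} (g : List A → Vec Bool k) →
          (∀ a w w′ → g w ≡ g w′ → g (a ∷ w) ≡ g (a ∷ w′)) →
          ∀ w → ∃[ w′ ] length w′ ≤ 2 ^ k × g w′ ≡ g w
shorten {A = A} {k} g g-cong w = go w (<-wellFounded (length w))
  where
  ++-cong : ∀ u {w w′} → g w ≡ g w′ → g (u ++ w) ≡ g (u ++ w′)
  ++-cong []      eq = eq
  ++-cong (a ∷ u) eq = g-cong a _ _ (++-cong u eq)

  go : ∀ w → Acc _<_ (length w) → ∃[ w′ ] length w′ ≤ 2 ^ k × g w′ ≡ g w
  go w (acc rs) with length w ≤? 2 ^ k
  ... | yes short = w , short , refl
  ... | no long
    -- There are `suc (length w)` suffixes, the empty one included, and only `2 ^ k` states.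
    with i , j , i<j , eq ← pigeonhole (m≤n⇒m≤1+n (≰⇒> long))
           (λ (i : Fin (suc (length w))) → encode (g (drop (toℕ i) w)))
    = let m      = toℕ i
          n      = toℕ j
          cut    = take m w ++ drop n w
          n≤     = toℕ≤pred[n] j
          cut<   = begin-strict
            length cut                             ≡⟨ length-++ (take m w) ⟩
            length (take m w) + length (drop n w)
              ≡⟨ cong₂ _+_ (length-take m w) (length-drop n w) ⟩
            (m ⊓ length w) + (length w ∸ n)        ≤⟨ +-monoˡ-≤ (length w ∸ n) (m⊓n≤m m (length w)) ⟩
            m + (length w ∸ n)                     <⟨ +-monoˡ-< (length w ∸ n) i<j ⟩
            n + (length w ∸ n)                     ≡⟨ m+[n∸m]≡n n≤ ⟩
            length w                               ∎
          w′ , short , g-eq = go cut (rs cut<)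
      in w′ , short , trans g-eq (trans (++-cong (take m w) (sym (encode-injective eq)))
                                        (cong g (take++drop≡id m w)))
    where open ≤-Reasoning

-- One bit per nonempty suffix of the path: the recursion for a suffix refers to the next shorter
-- one, so the bit of the whole path alone could not be updated letter by letter.
untils : (ps : Path s) → DataInstance s → Vec Bool (length ps)
untils []         D = []
untils (lr ∷ ps) D = until (lr ∷ ps) D ∷ untils ps D

untils⇒until : ∀ (ps : Path s) {D D′} → untils ps D ≡ untils ps D′ → until ps D ≡ until ps D′
untils⇒until []       eq = refl
untils⇒until (_ ∷ ps) eq = proj₁ (∷-injective eq)

untils-cong : ∀ (ps : Path s) δ D D′ → D at 0 ≡ D′ at 0 → untils ps D ≡ untils ps D′ →
              untils ps (δ ∷ D) ≡ untils ps (δ ∷ D′)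
untils-cong [] δ D D′ at≡ eq = refl
untils-cong ((l , r) ∷ ps) δ D D′ at≡ eq with eq₁ , eqs ← ∷-injective eq
  rewrite at≡ | untils⇒until ps eqs | eq₁ = cong (_ ∷_) (untils-cong ps δ D D′ at≡ eqs)

-- The state consists of the first letter and the suffix bits of both paths, so a single shortening
-- preserves both truth values; the exponent counts its bits.
short-instance : ∀ (p p′ : PathQuery s) D →
  ∃[ D′ ] length D′ ≤ 2 ^ (s + (length (proj₂ p) + length (proj₂ p′))) ×
          holds p D′ ≡ holds p D × holds p′ D′ ≡ holds p′ D
short-instance {s} (r , ps) (r′ , ps′) D =
  let D′ , short , eq = shorten state state-cong D
      at≡ , eq₁ , eq₂ = split D′ D eq
  in D′ , short ,
     cong₂ (λ δ b → (r ⊆ᵇ δ) ∧ b) at≡ (untils⇒until ps eq₁) ,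
     cong₂ (λ δ b → (r′ ⊆ᵇ δ) ∧ b) at≡ (untils⇒until ps′ eq₂)
  where
  state : DataInstance s → Vec Bool (s + (length ps + length ps′))
  state D = (D at 0) Vec.++ (untils ps D Vec.++ untils ps′ D)

  split : ∀ D D′ → state D ≡ state D′ →
          D at 0 ≡ D′ at 0 × untils ps D ≡ untils ps D′ × untils ps′ D ≡ untils ps′ D′
  split D D′ eq =
    let at≡ , rest = ++-injective (D at 0) (D′ at 0) eq
    in at≡ , ++-injective (untils ps D) (untils ps D′) rest

  state-cong : ∀ δ D D′ → state D ≡ state D′ → state (δ ∷ D) ≡ state (δ ∷ D′)
  state-cong δ D D′ eq =
    let at≡ , eq₁ , eq₂ = split D D′ eq
    in cong (δ Vec.++_) (cong₂ Vec._++_ (untils-cong ps δ D D′ at≡ eq₁) (untils-cong ps′ δ D D′ at≡ eq₂))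

-- Enumerations

length-cartesianProductWith : ∀ (f : A → B → C) xs ys →
  length (cartesianProductWith f xs ys) ≡ length xs * length ys
length-cartesianProductWith f [] ys = refl
length-cartesianProductWith f (x ∷ xs) ys =
  trans (length-++ (map (f x) ys))
        (cong₂ _+_ (length-map (f x) ys) (length-cartesianProductWith f xs ys))

subsets : ∀ s → List (Subset s)
subsets zero    = [] ∷ []
subsets (suc s) = cartesianProductWith _∷_ (true ∷ false ∷ []) (subsets s)

∈-subsets : (δ : Subset s) → δ ∈ subsets s
∈-subsets []          = here refl
∈-subsets (true  ∷ δ) = ∈-cartesianProductWith⁺ _∷_ {xs = true ∷ false ∷ []} (here refl) (∈-subsets δ)
∈-subsets (false ∷ δ) = ∈-cartesianProductWith⁺ _∷_ {xs = true ∷ false ∷ []} (there (here refl)) (∈-subsets δ)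

length-subsets : ∀ s → length (subsets s) ≡ 2 ^ s
length-subsets zero    = refl
length-subsets (suc s) =
  trans (length-cartesianProductWith _∷_ (true ∷ false ∷ []) (subsets s)) (cong (2 *_) (length-subsets s))

words : List A → ℕ → List (List A)
words as zero    = [] ∷ []
words as (suc n) = [] ∷ cartesianProductWith _∷_ as (words as n)

∈-words⁺ : ∀ {as : List A} → (∀ a → a ∈ as) → ∀ w {n} → length w ≤ n → w ∈ words as n
∈-words⁺ all []      {zero}  _         = here refl
∈-words⁺ all []      {suc n} _         = here refl
∈-words⁺ all (a ∷ w) {suc n} (s≤s w≤n) =
  there (∈-cartesianProductWith⁺ _∷_ (all a) (∈-words⁺ all w w≤n))

∈-words⁻ : ∀ {as : List A} n {w} → w ∈ words as n → length w ≤ n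
∈-words⁻ zero    (here refl) = z≤n
∈-words⁻ (suc n) (here refl) = z≤n
∈-words⁻ {as = as} (suc n) (there w∈)
  with _ , _ , _ , w′∈ , refl ← ∈-cartesianProductWith⁻ _∷_ as (words as n) w∈ = s≤s (∈-words⁻ n w′∈)

-- At each of `n` places a word continues with some letter or has already ended, which gives at most
-- `suc (length as)` choices per place.
length-words : ∀ (as : List A) {e} → suc (length as) ≤ 2 ^ e → ∀ n → length (words as n) ≤ 2 ^ (e * n)
length-words as {e} bound zero = ≤-reflexive (cong (2 ^_) (sym (*-zeroʳ e)))
length-words as {e} bound (suc n) = begin
  suc (length (cartesianProductWith _∷_ as (words as n)))
    ≡⟨ cong suc (length-cartesianProductWith _∷_ as (words as n)) ⟩
  suc (length as * length (words as n))
    ≤⟨ +-mono-≤ (m^n>0 2 (e * n)) (*-monoʳ-≤ (length as) (length-words as {e} bound n)) ⟩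
  suc (length as) * 2 ^ (e * n)
    ≤⟨ *-monoˡ-≤ (2 ^ (e * n)) bound ⟩
  2 ^ e * 2 ^ (e * n)
    ≡⟨ ^-distribˡ-+-* 2 e (e * n) ⟨
  2 ^ (e + e * n)
    ≡⟨ cong (2 ^_) (*-suc e n) ⟨
  2 ^ (e * suc n) ∎
  where open ≤-Reasoning

guards : ∀ s → List (Guard s)
guards s = nothing ∷ map just (subsets s)

∈-guards : (l : Guard s) → l ∈ guards s
∈-guards nothing  = here refl
∈-guards (just l) = there (∈-map⁺ just (∈-subsets l))

labels : ∀ s → List (Guard s × Subset s)
labels s = cartesianProduct (guards s) (subsets s)

∈-labels : (lr : Guard s × Subset s) → lr ∈ labels s
∈-labels (l , r) = ∈-cartesianProduct⁺ (∈-guards l) (∈-subsets r)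

-- The leading `suc` is the one that `length-words` asks for. With `N = 2 ^ s` the count is at most
-- `3 * (N * N)`, rounded up to factor 4 to reach a power of two.
length-labels : ∀ s → suc (length (labels s)) ≤ 2 ^ (2 + (s + s))
length-labels s = begin
  suc (length (labels s))
    ≡⟨ cong suc (length-cartesianProductWith _,_ (guards s) (subsets s)) ⟩
  suc (suc (length (map just (subsets s))) * length (subsets s))
    ≡⟨ cong₂ (λ x y → suc (suc x * y)) (trans (length-map just (subsets s)) (length-subsets s)) (length-subsets s) ⟩
  1 + (1 + N) * N
    ≤⟨ +-mono-≤ (*-mono-≤ 1≤N 1≤N) (*-monoˡ-≤ N (+-monoˡ-≤ N 1≤N)) ⟩
  N * N + (N + N) * N
    ≤⟨ m≤n+m (N * N + (N + N) * N) (N * N) ⟩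
  N * N + (N * N + (N + N) * N)
    ≡⟨ solve 1 (λ N → N :* N :+ (N :* N :+ (N :+ N) :* N) := con 4 :* (N :* N)) refl N ⟩
  4 * (N * N)
    ≡⟨ cong (4 *_) (^-distribˡ-+-* 2 s s) ⟨
  4 * 2 ^ (s + s)
    ≡⟨ ^-distribˡ-+-* 2 2 (s + s) ⟨
  2 ^ (2 + (s + s)) ∎
  where
  open ≤-Reasoning
  open +-*-Solver
  N = 2 ^ s
  1≤N = m^n>0 2 s

candidates : ∀ s → ℕ → List (PathQuery s)
candidates s n = cartesianProduct (subsets s) (words (labels s) n)

∈-candidates : ∀ {n} (p : PathQuery s) → length (proj₂ p) ≤ n → p ∈ candidates s n
∈-candidates (r , ps) ps≤n = ∈-cartesianProduct⁺ (∈-subsets r) (∈-words⁺ ∈-labels ps ps≤n)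

length-candidates : ∀ s n → length (candidates s n) ≤ 2 ^ (s + (2 + (s + s)) * n)
length-candidates s n = begin
  length (candidates s n)
    ≡⟨ length-cartesianProductWith _,_ (subsets s) (words (labels s) n) ⟩
  length (subsets s) * length (words (labels s) n)
    ≤⟨ *-mono-≤ (≤-reflexive (length-subsets s)) (length-words (labels s) {2 + (s + s)} (length-labels s) n) ⟩
  2 ^ s * 2 ^ ((2 + (s + s)) * n)
    ≡⟨ ^-distribˡ-+-* 2 s ((2 + (s + s)) * n) ⟨
  2 ^ (s + (2 + (s + s)) * n) ∎
  where open ≤-Reasoning

-- Size estimates

n≤2^n : ∀ n → n ≤ 2 ^ n
n≤2^n zero    = z≤n
n≤2^n (suc n) = +-mono-≤ (m^n>0 2 n) (≤-trans (n≤2^n n) (m≤m+n (2 ^ n) 0))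

sizeᴰ-bound : (D : DataInstance s) → sizeᴰ D ≤ length D * s
sizeᴰ-bound []      = z≤n
sizeᴰ-bound (δ ∷ D) = +-mono-≤ (∣p∣≤n δ) (sizeᴰ-bound D)

sum-map-bound : ∀ (f : A → ℕ) {b xs} → All (λ x → f x ≤ b) xs → sum (map f xs) ≤ length xs * b
sum-map-bound f []         = z≤n
sum-map-bound f (fx ∷ fxs) = +-mono-≤ fx (sum-map-bound f fxs)

-- The example set: construction, uniqueness and size

module Characterisation (p : PathQuery s) where

  -- The number of positions of `canonical p`, hence by `trim` a bound on the depth to which every
  -- fitting query reduces.
  n : ℕ
  n = suc (length (proj₂ p))

  maxLength : ℕ
  maxLength = 2 ^ (s + (n + n))

  Distinguishes : PathQuery s → DataInstance s → Set
  Distinguishes c D = holds p D ≢ holds c D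

  distinguishes? : ∀ c D → Dec (Distinguishes c D)
  distinguishes? c D = ¬? (holds p D ≟ᵇ holds c D)

  instances : List (DataInstance s)
  instances = words (subsets s) maxLength

  witness : PathQuery s → DataInstance s
  witness c with any? (distinguishes? c) instances
  ... | yes found = proj₁ (find found)
  -- Any short instance would do as default: each witness is later labelled by its truth value under
  -- `p`, so `p` still fits.
  ... | no  _     = []

  length-witness : ∀ c → length (witness c) ≤ maxLength
  length-witness c with any? (distinguishes? c) instances
  ... | yes found = ∈-words⁻ maxLength (proj₁ (proj₂ (find found)))
  ... | no  _     = z≤n

  -- If some instance told `p` and `c` apart, a short one would too by `short-instance`; the search
  -- would then have succeeded, and its result could not be an instance of agreement.
  witness-complete : ∀ c → length (proj₂ c) ≤ n → holds p (witness c) ≡ holds c (witness c) →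
                     holds p ≗ holds c
  witness-complete c c≤n agree D with any? (distinguishes? c) instances
  ... | yes found = contradiction agree (proj₂ (proj₂ (find found)))
  ... | no  none  = decidable-stable (holds p D ≟ᵇ holds c D) λ differ →
    let D′ , short , eq , eq′ = short-instance p c D
        short′ = ≤-trans short (^-monoʳ-≤ 2 (+-monoʳ-≤ s (+-mono-≤ (n≤1+n _) c≤n)))
    in none (lose (∈-words⁺ ∈-subsets D′ short′) (λ eq″ → differ (trans (sym eq) (trans eq″ eq′))))

  witnesses : List (DataInstance s)
  witnesses = map witness (candidates s n)

  holds? : ∀ D → Dec (T (holds p D))
  holds? D = T? (holds p D)

  -- Sorting the witnesses by their value under `p` makes `p` fit by construction and forces any
  -- other fitting query to agree with `p` on all of them.
  E : ExampleSet s
  E = examples (canonical p ∷ filter holds? witnesses) (filter (¬? ∘ holds?) witnesses)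

  E-fits : All (T ∘ holds p) (E⁺ E) × All (¬_ ∘ T ∘ holds p) (E⁻ E)
  E-fits = holds-canonical p ∷ all-filter holds? witnesses , all-filter (¬? ∘ holds?) witnesses

  T-injective : ∀ {b c} → (T b → T c) → (¬ T b → ¬ T c) → b ≡ c
  T-injective {true}  {true}  _ _ = refl
  T-injective {true}  {false} f _ = ⊥-elim (f tt)
  T-injective {false} {true}  _ g = ⊥-elim (g (λ ()) tt)
  T-injective {false} {false} _ _ = refl

  -- The canonical example lets `trim` replace `p′` by an equivalent candidate `c`. The witness for
  -- `c` is among the examples, so `p` and `c` agree on it and hence everywhere.
  E-unique : ∀ p′ → All (T ∘ holds p′) (E⁺ E) → All (¬_ ∘ T ∘ holds p′) (E⁻ E) → holds p ≗ holds p′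
  E-unique (r , ps) (h ∷ h⁺) h⁻
    with ps′ , ps′≤ , ps≗ps′ ← trim ps (canonical p) (proj₂ (to (T-∧ {r ⊆ᵇ proj₁ p}) h)) =
    λ D → trans (witness-complete c c≤n agree D) (sym (p′≗c D))
    where
    c : PathQuery s
    c = r , ps′

    p′≗c : holds (r , ps) ≗ holds c
    p′≗c D = cong ((r ⊆ᵇ (D at 0)) ∧_) (ps≗ps′ D)

    -- Position 0 of `canonical p` is counted too, so `c` may be one step deeper than `p`.
    c≤n : length ps′ ≤ n
    c≤n = ≤-trans ps′≤ (≤-reflexive (cong suc (length-map proj₂ (proj₂ p))))

    w∈ : witness c ∈ witnesses
    w∈ = ∈-map⁺ witness (∈-candidates c c≤n)

    agree : holds p (witness c) ≡ holds c (witness c)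
    agree = trans
      (T-injective (λ t → All.lookup h⁺ (∈-filter⁺ holds? w∈ t))
                   (λ f → All.lookup h⁻ (∈-filter⁺ (¬? ∘ holds?) w∈ f)))
      (p′≗c (witness c))

  length-canonical : length (canonical p) ≤ maxLength
  length-canonical = begin
    length (canonical p)  ≡⟨ cong suc (length-map proj₂ (proj₂ p)) ⟩
    n                     ≤⟨ n≤2^n n ⟩
    2 ^ n                 ≤⟨ ^-monoʳ-≤ 2 (≤-trans (m≤m+n n n) (m≤n+m (n + n) s)) ⟩
    maxLength             ∎
    where open ≤-Reasoning

  short-examples : All (λ D → length D ≤ maxLength) (E⁺ E ++ E⁻ E)
  short-examples = length-canonical ∷ Allₚ.++⁺ (Allₚ.filter⁺ holds? short) (Allₚ.filter⁺ (¬? ∘ holds?) short)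
    where
    short : All (λ D → length D ≤ maxLength) witnesses
    short = Allₚ.map⁺ (All.universal length-witness (candidates s n))

  -- Bounding both filtered lists by all witnesses at most doubles the count; together with the
  -- canonical example, four times the bound on the candidates suffices.
  number-of-examples : length (E⁺ E ++ E⁻ E) ≤ 2 ^ (2 + (s + (2 + (s + s)) * n))
  number-of-examples = begin
    suc (length (filter holds? witnesses ++ filter (¬? ∘ holds?) witnesses))
      ≡⟨ cong suc (length-++ (filter holds? witnesses)) ⟩
    suc (length (filter holds? witnesses) + length (filter (¬? ∘ holds?) witnesses))
      ≤⟨ s≤s (+-mono-≤ (≤-trans (length-filter holds? witnesses) w≤) (≤-trans (length-filter (¬? ∘ holds?) witnesses) w≤)) ⟩
    1 + (M + M)
      ≤⟨ +-mono-≤ (≤-trans (m^n>0 2 m) (m≤m+n M M)) ≤-refl ⟩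
    (M + M) + (M + M)
      ≡⟨ solve 1 (λ M → (M :+ M) :+ (M :+ M) := con 4 :* M) refl M ⟩
    4 * M
      ≡⟨ ^-distribˡ-+-* 2 2 m ⟨
    2 ^ (2 + m) ∎
    where
    open ≤-Reasoning
    open +-*-Solver
    m = s + (2 + (s + s)) * n
    M = 2 ^ m
    w≤ : length witnesses ≤ M
    w≤ = ≤-trans (≤-reflexive (length-map witness (candidates s n))) (length-candidates s n)

  sizeᴱ-bound : sizeᴱ E ≤ 2 ^ (2 + (s + (2 + (s + s)) * n) + (s + (n + n) + s))
  sizeᴱ-bound = begin
    sizeᴱ E
      ≤⟨ sum-map-bound sizeᴰ (All.map (λ {D} D≤ → ≤-trans (sizeᴰ-bound D) (*-monoˡ-≤ s D≤)) short-examples) ⟩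
    length (E⁺ E ++ E⁻ E) * (maxLength * s)
      -- The factor `s` is enlarged to `2 ^ s` so that the whole product becomes one power of two.
      ≤⟨ *-mono-≤ number-of-examples (*-monoʳ-≤ maxLength (n≤2^n s)) ⟩
    2 ^ a * (2 ^ (s + (n + n)) * 2 ^ s)
      ≡⟨ cong (2 ^ a *_) (^-distribˡ-+-* 2 (s + (n + n)) s) ⟨
    2 ^ a * 2 ^ (s + (n + n) + s)
      ≡⟨ ^-distribˡ-+-* 2 a (s + (n + n) + s) ⟨
    2 ^ (a + (s + (n + n) + s)) ∎
    where
    open ≤-Reasoning
    a = 2 + (s + (2 + (s + s)) * n)

-- Unique characterisation with an exponent linear in the query size

corollary10 : (s : ℕ) → .{{_ : NonZero s}} →
    ExponentiallyCharacterisable (𝒬p[U] {s}) (𝒬p[U] {s})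
-- The signature is fixed, so `s` may enter the coefficients; they are read off from the exponent in
-- `sizeᴱ-bound`, which is linear in the depth.
corollary10 s = (2 + 3 * s) ∷ (4 + 2 * s) ∷ [] , characterise
  where
  -- The right-hand side is `eval` unfolded in Horner form, whence the final `n * 0`.
  exponent : ∀ s n → 2 + (s + (2 + (s + s)) * n) + (s + (n + n) + s)
                     ≡ 2 + 3 * s + n * (4 + 2 * s + n * 0)
  exponent = solve 2 (λ s n →
    con 2 :+ (s :+ (con 2 :+ (s :+ s)) :* n) :+ (s :+ (n :+ n) :+ s)
    := con 2 :+ con 3 :* s :+ n :* (con 4 :+ con 2 :* s :+ n :* con 0)) refl
    where open +-*-Solver

  characterise : ∀ q → 𝒬p[U] q →
    ∃[ E ] UniquelyCharacterises E q 𝒬p[U] × sizeᴱ E ≤ 2 ^ eval ((2 + 3 * s) ∷ (4 + 2 * s) ∷ []) (sizeQ q)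
  characterise q 𝒬q with p , q⇔p , n≤ ← normalise 𝒬q = E , (fits , unique) , size
    where
    open Characterisation p

    fits : Fits q E
    fits = All.map (λ {D} → from (q⇔p D)) (proj₁ E-fits) ,
           All.map (λ {D} ¬h h → ¬h (to (q⇔p D) h)) (proj₂ E-fits)

    unique : ∀ q′ → 𝒬p[U] q′ → Fits q′ E → q ≡Q q′
    unique q′ 𝒬q′ (h⁺ , h⁻) with p′ , q′⇔p′ , _ ← normalise 𝒬q′ =
      ≡Q-from-0 λ D → q⇔p D ⇔⨾ (subst (λ b → T (holds p D) ⇔ T b) (p≗p′ D) (⇔-id _) ⇔⨾ ⇔-sym (q′⇔p′ D))
      where
      p≗p′ : holds p ≗ holds p′
      p≗p′ = E-unique p′ (All.map (λ {D} → to (q′⇔p′ D)) h⁺)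
                         (All.map (λ {D} ¬h h → ¬h (from (q′⇔p′ D) h)) h⁻)

    size : sizeᴱ E ≤ 2 ^ eval ((2 + 3 * s) ∷ (4 + 2 * s) ∷ []) (sizeQ q)
    size = ≤-trans sizeᴱ-bound (^-monoʳ-≤ 2 (≤-trans (≤-reflexive (exponent s n))
      (+-monoʳ-≤ (2 + 3 * s) (*-mono-≤ n≤ (+-monoʳ-≤ (4 + 2 * s) (*-monoˡ-≤ 0 n≤))))))
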